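{- The map $\delta$ restricts to a bijection from the set of signed permutations $B_n$ to the set of centrally symmetric noncrossing arc diagrams on the $2n$ points $-n,\ldots,-1,1,\ldots,n$.
   Context: $B_n$ is the set of signed permutations of $\{\pm1,\ldots,\pm n\}$: bijections $\pi$ of this set with $\pi(-i)=-\pi(i)$; write $\pi_i=\pi(i)$, with long one-line notation $\pi_{ -n}\cdots\pi_{ -1}\pi_1\cdots\pi_n$. Place $2n$ points on a vertical line, labeled $-n,\ldots,-1,1,\ldots,n$ from bottom to top, positioned so that the half-turn $x\mapsto -x$ about the origin sends point $i$ to point $-i$. An arc is a curve from a labeled point $q$ to a strictly lower labeled point $p$, monotone downward, touching no other labeled point, passing to the left or right of each labeled point strictly between; arcs are considered up to combinatorial equivalence (same endpoints, same points on each side). Two arcs are compatible if they do not intersect except possibly at a common endpoint and do not share an upper endpoint or a lower endpoint. A noncrossing arc diagram is a set of pairwise compatible arcs (up to combinatorial equivalence); it is centrally symmetric if it is invariant under the half-turn. The map $\delta$ on permutations $\pi$ of $\{\pm1,\ldots,\pm n\}$ (positions ordered $-n<\cdots<-1<1<\cdots<n$): for each pair of consecutive positions $a$ (immediately before) $b$ with $\pi_a>\pi_b$, $\delta(\pi)$ contains an arc from $\pi_a$ down to $\pi_b$ passing to the right of every $\pi_c$ with $\pi_b<\pi_c<\pi_a$ and $c$ before $a$, and to the left of every such $\pi_c$ with $c$ after $b$; these are all its arcs. -}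

module Defs where

import Data.Nat
open import Data.Nat using (ℕ; zero; suc; _+_)
open import Data.Fin using (Fin; zero; suc; inject₁; opposite; _<_; _≤_; _≟_; _<?_; _≤?_)
open import Data.Fin.Permutation using (Permutation; _⟨$⟩ʳ_; _⟨$⟩ˡ_)
open import Data.Bool using (Bool; true; false; not; if_then_else_)
open import Data.List using (List; []; _∷_; map; allFin; concatMap)
open import Data.List.Relation.Unary.Any using (Any)
open import Data.Product using (Σ; _×_; _,_; ∃)
open import Data.Empty using (⊥)
open import Relation.Nullary using (¬_; yes; no; Dec)
open import Relation.Nullary.Decidable using (⌊_⌋)
open import Relation.Binary.PropositionalEquality using (_≡_; _≢_; subst₂; sym)
open import Function.Bundles using (_⇔_)

-- Conventions.  The 2n labeled points -n < ... < -1 < 1 < ... < n are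
-- encoded, order-preservingly, by Fin (n + n): index k ↦ label k - n for
-- k < n and k - n + 1 for k ≥ n.  Under this encoding, the half-turn
-- x ↦ -x is 'opposite' (k ↦ 2n - 1 - k).  Positions of a permutation are
-- encoded the same way.  We work with a general number m of points and
-- specialise to m = n + n in the statement.

-- An arc from upper point 'hi' down to lower point 'lo'.  'left c' says
-- whether the arc passes to the LEFT of the labeled point c; it is only
-- meaningful for lo < c < hi (combinatorial equivalence ignores the rest).
record Arc (m : ℕ) : Set where
  constructor arc
  field
    lo   : Fin m
    hi   : Fin m
    lo<hi : lo < hi
    left : Fin m → Bool
open Arc public

Between : ∀ {m} → Arc m → Fin m → Set
Between α c = lo α < c × c < hi α

_≈ₐ_ : ∀ {m} → Arc m → Arc m → Set
α ≈ₐ β = lo α ≡ lo β × hi α ≡ hi β × (∀ c → Between α c → left α c ≡ left β c)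

InRange : ∀ {m} → Arc m → Fin m → Set
InRange α c = lo α ≤ c × c ≤ hi α

-- horizontal position of the arc at the height of point c (for c in the
-- range): 0 = arc is left of c, 1 = arc is at c (endpoint), 2 = right of c
pos : ∀ {m} → Arc m → Fin m → ℕ
pos α c with c ≟ lo α | c ≟ hi α
... | yes _ | _     = 1
... | no _  | yes _ = 1
... | no _  | no _  = if left α c then 0 else 2

-- two arcs (drawn as monotone curves) are forced to intersect away from
-- a common endpoint iff their left/right order at some common height is
-- the opposite of their order at another common height
Crosses : ∀ {m} → Arc m → Arc m → Set
Crosses {m} α β = Σ (Fin m) λ c → Σ (Fin m) λ c' →
  InRange α c × InRange β c × InRange α c' × InRange β c' ×
  Data.Nat._<_ (pos α c) (pos β c) × Data.Nat._<_ (pos β c') (pos α c')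

Compatible : ∀ {m} → Arc m → Arc m → Set
Compatible α β = ¬ Crosses α β × lo α ≢ lo β × hi α ≢ hi β

-- An arc diagram is a finite set of arcs (up to combinatorial
-- equivalence), represented by a list; membership is up to ≈ₐ.
Diagram : ℕ → Set
Diagram m = List (Arc m)

_∈ₐ_ : ∀ {m} → Arc m → Diagram m → Set
α ∈ₐ D = Any (α ≈ₐ_) D

_≈D_ : ∀ {m} → Diagram m → Diagram m → Set
_≈D_ {m} D E = (α : Arc m) → (α ∈ₐ D) ⇔ (α ∈ₐ E)

NoncrossingDiagram : ∀ {m} → Diagram m → Set
NoncrossingDiagram D = ∀ α β → α ∈ₐ D → β ∈ₐ D → ¬ (α ≈ₐ β) → Compatible α β

opposite-< : ∀ {m} {i j : Fin m} → i < j → opposite j < opposite i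
opposite-< {m} {i} {j} p =
  subst₂ Data.Nat._<_ (sym (FP.opposite-prop j)) (sym (FP.opposite-prop i))
    (NP.∸-monoʳ-< (Data.Nat.s≤s p) (FP.toℕ<n j))
  where
  import Data.Fin.Properties as FP
  import Data.Nat.Properties as NP

halfTurn : ∀ {m} → Arc m → Arc m
halfTurn α = arc (opposite (hi α)) (opposite (lo α)) (opposite-< (lo<hi α))
                 (λ c → not (left α (opposite c)))

CentrallySymmetric : ∀ {m} → Diagram m → Set
CentrallySymmetric D = ∀ α → α ∈ₐ D → halfTurn α ∈ₐ D

CSNCDiagram : ∀ {m} → Diagram m → Set
CSNCDiagram D = NoncrossingDiagram D × CentrallySymmetric D

IsSigned : ∀ {m} → Permutation m m → Set
IsSigned {m} π = ∀ (i : Fin m) → π ⟨$⟩ʳ opposite i ≡ opposite (π ⟨$⟩ʳ i)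

consecutive : (m : ℕ) → List (Fin m × Fin m)
consecutive zero    = []
consecutive (suc k) = map (λ i → inject₁ i , suc i) (allFin k)

-- the arc of a descent π_a > π_b at consecutive positions a, b: it passes
-- right of values at positions before a, left of values at positions after b
descentArc : ∀ {m} → Permutation m m → Fin m → (b a : Fin m) → b < a → Arc m
descentArc π pa vb va lt =
  arc vb va lt (λ v → not ⌊ (π ⟨$⟩ˡ v) ≤? pa ⌋)

δ : ∀ {m} → Permutation m m → Diagram m
δ {m} π = concatMap step (consecutive m)
  where
  step : Fin m × Fin m → List (Arc m)
  step (a , b) with (π ⟨$⟩ʳ b) <? (π ⟨$⟩ʳ a)
  ... | yes lt = descentArc π a (π ⟨$⟩ʳ b) (π ⟨$⟩ʳ a) lt ∷ []
  ... | no _   = []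

{-# OPTIONS --safe #-}
-- A pair y > x is inverted by an arc from hi to lo if lo ≤ x < y ≤ hi, y is hi or lies left of
-- the arc, and x is lo or lies right of it.  For any diagram D, the transitive closure of
-- "inverted by some arc of D" is the inversion set of a permutation: a point strictly between x
-- and y lies left or right of the arc, so an inverted pair always splits at it.  If D is
-- noncrossing, a chain of inversions starting at hi or ending at lo cannot pass through an arc
-- of D, hence hi and lo are adjacent in this permutation, which therefore has D as its descent
-- arcs.  Conversely, the inversions of π are the closure of the pairs inverted by δ π, so δ is
-- injective.  Conjugating π by the half-turn rotates δ π, and injectivity then matches signed
-- permutations with centrally symmetric diagrams.
module Submission where

open import Defs
open import Data.Bool using (true; false; not; if_then_else_)
open import Data.Bool.Properties using (not-injective; not-involutive) renaming (_≟_ to _≟ᵇ_)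
open import Data.Empty using (⊥-elim)
open import Data.Fin using (Fin; suc; toℕ; inject₁; fromℕ<; punchOut; opposite; _<_; _≤_; _>_; _≟_; _<?_; _≤?_)
open import Data.Fin.Induction using (<-wellFounded; >-wellFounded)
open import Data.Fin.Permutation using (Permutation; permutation; _⟨$⟩ʳ_; _⟨$⟩ˡ_; inverseˡ; inverseʳ; reverse; _∘ₚ_)
open import Data.Fin.Properties as Fin
  using (toℕ-injective; toℕ-fromℕ<; toℕ-inject₁; toℕ<n; <-cmp; <⇒≢; ≤∧≢⇒<; injective⇒≤; punchOut-injective; opposite-prop; opposite-involutive)
open import Data.Fin.Subset using (Subset; _∈_; ∣_∣)
open import Data.Fin.Subset.Properties using (p⊂q⇒∣p∣<∣q∣; ∣⊤∣≡n; ∈⊤)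
open import Data.List using (List; allFin; concatMap)
open import Data.List.Membership.Propositional using (find; lose) renaming (_∈_ to _∈ˡ_)
open import Data.List.Membership.Propositional.Properties using (∈-map⁺; ∈-map⁻; ∈-allFin)
open import Data.List.Relation.Unary.Any as Any using (Any; here)
open import Data.List.Relation.Unary.Any.Properties using (concatMap⁺; concatMap⁻)
open import Data.Nat as ℕ using (ℕ; suc; _+_; _∸_; z≤n; s≤s)
open import Data.Nat.Properties as ℕ
  using (<-irrefl; <-trans; <-≤-trans; ≤-<-trans; <⇒≤; ≤-refl; ≤-trans; ≤-reflexive; <-asym; <⇒≱; ≮⇒≥; ≰⇒>; suc-injective)
open import Data.Product using (Σ; Σ-syntax; ∃; _×_; _,_; proj₁; proj₂)
open import Data.Sum using (_⊎_; inj₁; inj₂)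
open import Data.Vec using (tabulate)
open import Data.Vec.Properties using (lookup∘tabulate; lookup⇒[]=; []=⇒lookup)
open import Function using (_∘_; mk⇔; Equivalence)
open import Function.Definitions using (Injective)
open import Induction.WellFounded using (Acc; acc)
open import Relation.Binary.Construct.Closure.Transitive using (TransClosure; [_]; _∷_; _++_)
open import Relation.Binary.Definitions using (Trichotomous; tri<; tri≈; tri>)
open import Relation.Binary.PropositionalEquality using (_≡_; _≢_; refl; sym; trans; cong; subst; subst₂; isEquivalence)
open import Relation.Binary.Structures using (IsStrictTotalOrder)
open import Relation.Binary.Structures.Biased using (isStrictTotalOrderᶜ)
open import Relation.Nullary using (¬_; Dec; yes; no; does; contradiction)
open import Relation.Nullary.Decidable using (_×-dec_; _⊎-dec_; map′; dec-true; ⌊_⌋)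

private variable
  m : ℕ
  α β : Arc m
  c x y z : Fin m

-- Horizontal positions and equivalence of arcs.

pos-lo : (α : Arc m) → pos α (lo α) ≡ 1
pos-lo α with lo α ≟ lo α | lo α ≟ hi α
... | yes _ | _ = refl
... | no c≢ | _ = contradiction refl c≢

pos-hi : (α : Arc m) → pos α (hi α) ≡ 1
pos-hi α with hi α ≟ lo α | hi α ≟ hi α
... | yes _ | _     = refl
... | no _  | yes _ = refl
... | no _  | no c≢  = contradiction refl c≢

pos-between : (α : Arc m) → Between α c → pos α c ≡ (if left α c then 0 else 2)
pos-between {c = c} α (lo<c , c<hi) with c ≟ lo α | c ≟ hi α
... | yes c≡lo | _ = contradiction (sym c≡lo) (<⇒≢ lo<c)
... | no _  | yes c≡hi = contradiction c≡hi (<⇒≢ c<hi)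
... | no _  | no _ = refl

pos-left : (α : Arc m) → Between α c → left α c ≡ true → pos α c ≡ 0
pos-left α b eq = trans (pos-between α b) (cong (if_then 0 else 2) eq)

pos-right : (α : Arc m) → Between α c → left α c ≡ false → pos α c ≡ 2
pos-right α b eq = trans (pos-between α b) (cong (if_then 0 else 2) eq)

Upper Lower : Arc m → Fin m → Set
Upper α y = y ≡ hi α ⊎ left α y ≡ false
Lower α x = x ≡ lo α ⊎ left α x ≡ true

-- The bound is weak because `left` may be read at an endpoint, where its value is arbitrary but
-- `pos` is 1.
Upper⇒1≤pos : (α : Arc m) → Upper α c → 1 ℕ.≤ pos α c
Upper⇒1≤pos {c = c} α u with c ≟ lo α | c ≟ hi α | u
... | yes _ | _     | _ = ≤-refl
... | no _  | yes _ | _ = ≤-refl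
... | no _  | no c≢ | inj₁ c≡ = contradiction c≡ c≢
... | no _  | no _  | inj₂ eq rewrite eq = s≤s z≤n

Lower⇒pos≤1 : (α : Arc m) → Lower α c → pos α c ℕ.≤ 1
Lower⇒pos≤1 {c = c} α l with c ≟ lo α | c ≟ hi α | l
... | yes _ | _     | _ = ≤-refl
... | no _  | yes _ | _ = ≤-refl
... | no c≢ | no _  | inj₁ c≡ = contradiction c≡ c≢
... | no _  | no _  | inj₂ eq rewrite eq = z≤n

endpoint-or-between : (α : Arc m) → InRange α c → c ≡ lo α ⊎ c ≡ hi α ⊎ Between α c
endpoint-or-between {c = c} α (lo≤c , c≤hi) with c ≟ lo α | c ≟ hi α
... | yes c≡lo | _        = inj₁ c≡lo
... | no _     | yes c≡hi = inj₂ (inj₁ c≡hi)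
... | no c≢lo  | no c≢hi  = inj₂ (inj₂ (≤∧≢⇒< lo≤c (c≢lo ∘ sym) , ≤∧≢⇒< c≤hi c≢hi))

≈ₐ-refl : (α : Arc m) → α ≈ₐ α
≈ₐ-refl _ = refl , refl , λ _ _ → refl

≈ₐ-sym : (α β : Arc m) → α ≈ₐ β → β ≈ₐ α
≈ₐ-sym _ _ (refl , refl , same) = refl , refl , λ c b → sym (same c b)

≈ₐ-trans : (α β γ : Arc m) → α ≈ₐ β → β ≈ₐ γ → α ≈ₐ γ
≈ₐ-trans _ _ _ (refl , refl , same) (refl , refl , same′) = refl , refl , λ c b → trans (same c b) (same′ c b)

∈ₐ-resp-≈ₐ : (α β : Arc m) {D : Diagram m} → α ≈ₐ β → α ∈ₐ D → β ∈ₐ D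
∈ₐ-resp-≈ₐ α β α≈β = Any.map λ {γ} → ≈ₐ-trans β α γ (≈ₐ-sym α β α≈β)

pos-cong : (α β : Arc m) → α ≈ₐ β → InRange α c → pos α c ≡ pos β c
pos-cong α β (refl , refl , same) r with endpoint-or-between α r
... | inj₁ refl        = trans (pos-lo α) (sym (pos-lo β))
... | inj₂ (inj₁ refl) = trans (pos-hi α) (sym (pos-hi β))
... | inj₂ (inj₂ b)    = trans (pos-between α b)
  (trans (cong (if_then 0 else 2) (same _ b)) (sym (pos-between β b)))

-- Inversions generated by a diagram.

-- (x , y) is an inversion of the smallest permutation, in the weak order, with descent arc α.
Separates : Arc m → Fin m → Fin m → Set
Separates α y x = lo α ≤ x × x < y × y ≤ hi α × Upper α y × Lower α x

separates? : (α : Arc m) (y x : Fin m) → Dec (Separates α y x)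
separates? α y x =
  (lo α ≤? x) ×-dec (x <? y) ×-dec (y ≤? hi α)
  ×-dec ((y ≟ hi α) ⊎-dec (left α y ≟ᵇ false))
  ×-dec ((x ≟ lo α) ⊎-dec (left α x ≟ᵇ true))

-- `≈ₐ` does not compare flags at endpoints. A point that is not the endpoint named in `Upper` or
-- `Lower` is strictly between by `x < y` and the range bounds, and there the flags agree.
separates-cong : (α β : Arc m) → α ≈ₐ β → Separates α y x → Separates β y x
separates-cong {y = y} {x = x} α β (refl , refl , same) (lo≤x , x<y , y≤hi , u , l) =
  lo≤x , x<y , y≤hi , upper u , lower l
  where
  upper : Upper α y → Upper β y
  upper (inj₁ y≡hi) = inj₁ y≡hi
  upper (inj₂ f) with y ≟ hi α
  ... | yes y≡hi = inj₁ y≡hi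
  ... | no  y≢hi = inj₂ (trans (sym (same y (≤-<-trans lo≤x x<y , ≤∧≢⇒< y≤hi y≢hi))) f)
  lower : Lower α x → Lower β x
  lower (inj₁ x≡lo) = inj₁ x≡lo
  lower (inj₂ t) with x ≟ lo α
  ... | yes x≡lo = inj₁ x≡lo
  ... | no  x≢lo = inj₂ (trans (sym (same x (≤∧≢⇒< lo≤x (x≢lo ∘ sym) , <-≤-trans x<y y≤hi))) t)

Inverts : Diagram m → Fin m → Fin m → Set
Inverts D y x = Any (λ α → Separates α y x) D

Inverts⁺ : Diagram m → Fin m → Fin m → Set
Inverts⁺ D = TransClosure (Inverts D)

inverts : (α : Arc m) {D : Diagram m} → α ∈ₐ D → Separates α y x → Inverts D y x
inverts α α∈D s = Any.map (λ {β} α≈β → separates-cong α β α≈β s) α∈D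

inverts-arc : {D : Diagram m} → Inverts D y x → ∃ λ α → α ∈ₐ D × Separates α y x
inverts-arc i with α , α∈D , s ← find i = α , Any.map (λ { refl → ≈ₐ-refl α }) α∈D , s

inverts⇒> : {D : Diagram m} → Inverts D y x → x < y
inverts⇒> i with _ , _ , _ , x<y , _ ← inverts-arc i = x<y

inverts⁺⇒> : {D : Diagram m} → Inverts⁺ D y x → x < y
inverts⁺⇒> [ i ]    = inverts⇒> i
inverts⁺⇒> (i ∷ is) = <-trans (inverts⁺⇒> is) (inverts⇒> i)

inverts⁺? : (D : Diagram m) (y x : Fin m) → Dec (Inverts⁺ D y x)
inverts⁺? {m} D y x = search (<-wellFounded y)
  where
  inverts? : (y x : Fin m) → Dec (Inverts D y x)
  inverts? y x = Any.any? (λ α → separates? α y x) D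
  search : ∀ {y} → Acc _<_ y → Dec (Inverts⁺ D y x)
  search {y} (acc rec) = map′ join split (inverts? y x ⊎-dec Fin.any? via?)
    where
    Via : Fin m → Set
    Via w = Inverts D y w × Inverts⁺ D w x
    via? : ∀ w → Dec (Via w)
    -- The first step is decided before the tail: its proof supplies the `w < y` that the recursive
    -- call needs.
    via? w with inverts? y w
    ... | no ¬i = no (¬i ∘ proj₁)
    ... | yes i = map′ (i ,_) proj₂ (search (rec (inverts⇒> i)))
    join : Inverts D y x ⊎ ∃ Via → Inverts⁺ D y x
    join (inj₁ i)            = [ i ]
    join (inj₂ (_ , i , is)) = i ∷ is
    split : Inverts⁺ D y x → Inverts D y x ⊎ ∃ Via
    split [ i ]    = inj₁ i
    split (i ∷ is) = inj₂ (_ , i , is)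

inverts-split : {D : Diagram m} → Inverts D z x → x < y → y < z → Inverts D z y ⊎ Inverts D y x
inverts-split {y = y} i x<y y<z with inverts-arc i
... | α , α∈D , lo≤x , _ , z≤hi , u , l with left α y in eq
... | true  = inj₁ (inverts α α∈D (≤-trans lo≤x (<⇒≤ x<y) , y<z , z≤hi , u , inj₂ eq))
... | false = inj₂ (inverts α α∈D (lo≤x , x<y , ≤-trans (<⇒≤ y<z) z≤hi , inj₂ eq , l))

-- The point `w` after the first step locates `y`: below `w` the tail is split, above `w` the first
-- step is, and `y ≡ w` is itself a splitting.
inverts⁺-split : {D : Diagram m} → Inverts⁺ D z x → x < y → y < z → Inverts⁺ D z y ⊎ Inverts⁺ D y x
inverts⁺-split [ i ] x<y y<z with inverts-split i x<y y<z
... | inj₁ j = inj₁ [ j ]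
... | inj₂ j = inj₂ [ j ]
inverts⁺-split {y = y} (_∷_ {y = w} i is) x<y y<z with <-cmp y w
... | tri≈ _ refl _ = inj₁ [ i ]
... | tri< y<w _ _ with inverts⁺-split is x<y y<w
...   | inj₁ js = inj₁ (i ∷ js)
...   | inj₂ js = inj₂ js
inverts⁺-split {y = y} (_∷_ {y = w} i is) x<y y<z | tri> _ _ w<y with inverts-split i w<y y<z
...   | inj₁ j = inj₁ [ j ]
...   | inj₂ j = inj₂ (j ∷ is)

-- The linear order with inversion set `Inverts⁺ D`.

module Order (D : Diagram m) where

  infix 4 _≺_
  _≺_ : Fin m → Fin m → Set
  x ≺ y = (x < y × ¬ Inverts⁺ D y x) ⊎ Inverts⁺ D x y

  ≺-irrefl : ¬ x ≺ x
  ≺-irrefl (inj₁ (x<x , _)) = <-irrefl refl x<x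
  ≺-irrefl (inj₂ is)        = <-irrefl refl (inverts⁺⇒> is)

  ≺-connected : x ≢ y → x ≺ y ⊎ y ≺ x
  ≺-connected {x} {y} x≢y with <-cmp x y
  ... | tri≈ _ x≡y _ = contradiction x≡y x≢y
  ... | tri< x<y _ _ with inverts⁺? D y x
  ...   | yes is = inj₂ (inj₂ is)
  ...   | no ¬is = inj₁ (inj₁ (x<y , ¬is))
  ≺-connected {x} {y} x≢y | tri> _ _ y<x with inverts⁺? D x y
  ...   | yes is = inj₁ (inj₂ is)
  ...   | no ¬is = inj₂ (inj₁ (y<x , ¬is))

  -- `Inverts⁺ D` is closed under composition and, by `inverts⁺-split`, so is its complement; these
  -- two properties characterise inversion sets. In the mixed cases the numerical order of `x` and
  -- `z` decides which one applies.
  ≺-trans : x ≺ y → y ≺ z → x ≺ z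
  ≺-trans {x} {y} {z} (inj₁ (x<y , ¬yx)) (inj₁ (y<z , ¬zy)) = inj₁ (<-trans x<y y<z , ¬zx)
    where
    ¬zx : ¬ Inverts⁺ D z x
    ¬zx zx with inverts⁺-split zx x<y y<z
    ... | inj₁ zy = ¬zy zy
    ... | inj₂ yx = ¬yx yx
  ≺-trans {x} {y} {z} (inj₁ (x<y , ¬yx)) (inj₂ yz) with <-cmp x z
  ... | tri< x<z _ _ = inj₁ (x<z , λ zx → ¬yx (yz ++ zx))
  ... | tri≈ _ refl _ = contradiction yz ¬yx
  ... | tri> _ _ z<x with inverts⁺-split yz z<x x<y
  ...   | inj₁ yx = contradiction yx ¬yx
  ...   | inj₂ xz = inj₂ xz
  ≺-trans {x} {y} {z} (inj₂ xy) (inj₁ (y<z , ¬zy)) with <-cmp x z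
  ... | tri< x<z _ _ = inj₁ (x<z , λ zx → ¬zy (zx ++ xy))
  ... | tri≈ _ refl _ = contradiction xy ¬zy
  ... | tri> _ _ z<x with inverts⁺-split xy y<z z<x
  ...   | inj₁ xz = inj₂ xz
  ...   | inj₂ zy = contradiction zy ¬zy
  ≺-trans (inj₂ xy) (inj₂ yz) = inj₂ (xy ++ yz)

  ≺-asym : x ≺ y → ¬ y ≺ x
  ≺-asym x≺y y≺x = ≺-irrefl (≺-trans x≺y y≺x)

  ≺-compare : Trichotomous _≡_ _≺_
  ≺-compare x y with x ≟ y
  ... | yes refl = tri≈ ≺-irrefl refl ≺-irrefl
  ... | no x≢y with ≺-connected x≢y
  ...   | inj₁ x≺y = tri< x≺y x≢y (≺-asym x≺y)
  ...   | inj₂ y≺x = tri> (≺-asym y≺x) x≢y y≺x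

  ≺-isStrictTotalOrder : IsStrictTotalOrder _≡_ _≺_
  ≺-isStrictTotalOrder = isStrictTotalOrderᶜ record
    { isEquivalence = isEquivalence ; trans = ≺-trans ; compare = ≺-compare }

  ≺∧>⇒inverts⁺ : x ≺ y → y < x → Inverts⁺ D x y
  ≺∧>⇒inverts⁺ (inj₁ (x<y , _)) y<x = contradiction y<x (<-asym x<y)
  ≺∧>⇒inverts⁺ (inj₂ is) _ = is

  -- Arcs of a noncrossing diagram as covers of `_≺_`.

  module _ (nc : NoncrossingDiagram D) where

    -- Arcs that differ at a common height are not equivalent, hence compatible.
    compatible : (α β : Arc m) → α ∈ₐ D → β ∈ₐ D →
                 ∀ c → InRange α c → InRange β c → pos α c ≢ pos β c → Compatible α β
    compatible α β α∈D β∈D c rα _ differ = nc α β α∈D β∈D λ α≈β → differ (pos-cong α β α≈β rα)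

    module _ (α : Arc m) (α∈D : α ∈ₐ D) where

      -- Unlike `Upper` and `Lower`, these demand `Between`, so the flag is never read where it is
      -- arbitrary.
      RightOf LeftOf : Fin m → Set
      RightOf y = y ≡ hi α ⊎ Between α y × left α y ≡ true
      LeftOf  x = x ≡ lo α ⊎ Between α x × left α x ≡ false

      between⇒range : (γ : Arc m) → Between γ c → InRange γ c
      between⇒range _ (lo<c , c<hi) = <⇒≤ lo<c , <⇒≤ c<hi

      rightOf⇒range : RightOf y → InRange α y
      rightOf⇒range (inj₁ refl)    = <⇒≤ (lo<hi α) , ≤-refl
      rightOf⇒range (inj₂ (b , _)) = between⇒range α b

      leftOf⇒range : LeftOf x → InRange α x
      leftOf⇒range (inj₁ refl)    = ≤-refl , <⇒≤ (lo<hi α)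
      leftOf⇒range (inj₂ (b , _)) = between⇒range α b

      -- At height `y` the arc `α` is strictly left of `β`, so `β` strictly left of `α` at another
      -- common height would be a crossing.
      uncrossed-below : RightOf y → β ∈ₐ D → Separates β y x →
                        ∀ c → InRange α c → InRange β c → ¬ pos β c ℕ.< pos α c
      uncrossed-below {y} {β} r β∈D (lo≤x , x<y , y≤hi , u , _) c rα rβ lt
        with compatible α β α∈D β∈D c rα rβ (λ eq → <-irrefl (sym eq) lt)
      ... | ¬cross , _ , hi≢ =
        ¬cross (y , c , rightOf⇒range r , (<⇒≤ (≤-<-trans lo≤x x<y) , y≤hi) , rα , rβ , pos< r u , lt)
        where
        pos< : RightOf y → Upper β y → pos α y ℕ.< pos β y
        pos< (inj₂ (b , t)) u = subst (ℕ._< pos β y) (sym (pos-left α b t)) (Upper⇒1≤pos β u)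
        pos< (inj₁ refl) (inj₁ ≡hi) = contradiction ≡hi hi≢
        pos< (inj₁ refl) (inj₂ f) = subst₂ ℕ._<_ (sym (pos-hi α))
          (sym (pos-right β (≤-<-trans lo≤x x<y , ≤∧≢⇒< y≤hi hi≢) f)) ≤-refl

      -- Half-turn mirror of `uncrossed-below`, with `x` as the reference height.
      uncrossed-above : LeftOf x → β ∈ₐ D → Separates β y x →
                        ∀ c → InRange α c → InRange β c → ¬ pos α c ℕ.< pos β c
      uncrossed-above {x} {β} l β∈D (lo≤x , x<y , y≤hi , _ , w) c rα rβ lt
        with compatible α β α∈D β∈D c rα rβ (λ eq → <-irrefl eq lt)
      ... | ¬cross , lo≢ , _ =
        ¬cross (c , x , rα , rβ , leftOf⇒range l , (lo≤x , <⇒≤ (<-≤-trans x<y y≤hi)) , lt , pos< l w)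
        where
        pos< : LeftOf x → Lower β x → pos β x ℕ.< pos α x
        pos< (inj₂ (b , f)) w = subst (pos β x ℕ.<_) (sym (pos-right α b f)) (s≤s (Lower⇒pos≤1 β w))
        pos< (inj₁ refl) (inj₁ ≡lo) = contradiction ≡lo lo≢
        pos< (inj₁ refl) (inj₂ t) = subst₂ ℕ._<_
          (sym (pos-left β (≤∧≢⇒< lo≤x (lo≢ ∘ sym) , <-≤-trans x<y y≤hi) t)) (sym (pos-lo α)) ≤-refl

      -- Invariants of chains of inversions. Descending from `hi α`, a chain stays right of `α`
      -- until it reaches or passes `lo α`, and from then on it can be rerouted through `lo α`.
      -- `Above` is the mirror image for chains climbing from `lo α`.
      Below Above : Fin m → Set
      Below w = RightOf w ⊎ w ≡ lo α ⊎ Inverts⁺ D (lo α) w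
      Above w = LeftOf w ⊎ w ≡ hi α ⊎ Inverts⁺ D w (hi α)

      -- If the arc `β` of the step led to a point left of `α`, or passed left of `lo α`, it would
      -- violate `uncrossed-below`. So when `x` lies below `lo α`, `β` passes right of `lo α` and
      -- inverts `lo α` with `x`.
      below-step : Below y → Inverts D y x → Below x
      below-step (inj₂ (inj₁ refl)) i = inj₂ (inj₂ [ i ])
      below-step (inj₂ (inj₂ is)) i   = inj₂ (inj₂ (is ++ [ i ]))
      below-step {y} {x} (inj₁ r) i with inverts-arc i | <-cmp x (lo α)
      ... | _ | tri≈ _ x≡lo _ = inj₂ (inj₁ x≡lo)
      ... | β , β∈D , s@(lo≤x , x<y , y≤hi , u , w) | tri> _ _ lo<x with left α x in eq
      ...   | true  = inj₁ (inj₂ ((lo<x , <-≤-trans x<y (proj₂ (rightOf⇒range r))) , refl))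
      ...   | false = ⊥-elim (uncrossed-below r β∈D s x (between⇒range α b) (lo≤x , <⇒≤ (<-≤-trans x<y y≤hi))
                        (subst (pos β x ℕ.<_) (sym (pos-right α b eq)) (s≤s (Lower⇒pos≤1 β w))))
        where
        b : Between α x
        b = lo<x , <-≤-trans x<y (proj₂ (rightOf⇒range r))
      below-step {y} {x} (inj₁ r) i | β , β∈D , s@(lo≤x , x<y , y≤hi , u , w) | tri< x<lo _ _
        with left β (lo α) in eq
      ...   | false = inj₂ (inj₂ [ inverts β β∈D (lo≤x , x<lo , ≤-trans (proj₁ (rightOf⇒range r)) y≤hi , inj₂ eq , w) ])
      ...   | true  = ⊥-elim (uncrossed-below r β∈D s (lo α) (≤-refl , <⇒≤ (lo<hi α)) (between⇒range β b)
                        (subst₂ ℕ._<_ (sym (pos-left β b eq)) (sym (pos-lo α)) ≤-refl))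
        where
        lo<y : RightOf y → lo α < y
        lo<y (inj₁ refl) = lo<hi α
        lo<y (inj₂ ((lo<y , _) , _)) = lo<y
        b : Between β (lo α)
        b = ≤-<-trans lo≤x x<lo , <-≤-trans (lo<y r) y≤hi

      above-step : Above x → Inverts D y x → Above y
      above-step (inj₂ (inj₁ refl)) i = inj₂ (inj₂ [ i ])
      above-step (inj₂ (inj₂ is)) i   = inj₂ (inj₂ (i ∷ is))
      above-step {x} {y} (inj₁ l) i with inverts-arc i | <-cmp y (hi α)
      ... | _ | tri≈ _ y≡hi _ = inj₂ (inj₁ y≡hi)
      ... | β , β∈D , s@(lo≤x , x<y , y≤hi , u , w) | tri< y<hi _ _ with left α y in eq
      ...   | false = inj₁ (inj₂ ((≤-<-trans (proj₁ (leftOf⇒range l)) x<y , y<hi) , refl))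
      ...   | true  = ⊥-elim (uncrossed-above l β∈D s y (between⇒range α b) (<⇒≤ (≤-<-trans lo≤x x<y) , y≤hi)
                        (subst (ℕ._< pos β y) (sym (pos-left α b eq)) (Upper⇒1≤pos β u)))
        where
        b : Between α y
        b = ≤-<-trans (proj₁ (leftOf⇒range l)) x<y , y<hi
      above-step {x} {y} (inj₁ l) i | β , β∈D , s@(lo≤x , x<y , y≤hi , u , w) | tri> _ _ hi<y
        with left β (hi α) in eq
      ...   | true  = inj₂ (inj₂ [ inverts β β∈D (≤-trans lo≤x (proj₂ (leftOf⇒range l)) , hi<y , y≤hi , u , inj₂ eq) ])
      ...   | false = ⊥-elim (uncrossed-above l β∈D s (hi α) (<⇒≤ (lo<hi α) , ≤-refl) (between⇒range β b)
                        (subst₂ ℕ._<_ (sym (pos-hi α)) (sym (pos-right β b eq)) ≤-refl))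
        where
        x<hi : LeftOf x → x < hi α
        x<hi (inj₁ refl) = lo<hi α
        x<hi (inj₂ ((_ , x<hi) , _)) = x<hi
        b : Between β (hi α)
        b = ≤-<-trans lo≤x (x<hi l) , <-≤-trans hi<y y≤hi

      below-chain : Below y → Inverts⁺ D y x → Below x
      below-chain b [ i ]    = below-step b i
      below-chain b (i ∷ is) = below-chain (below-step b i) is

      above-chain : Above x → Inverts⁺ D y x → Above y
      above-chain a [ i ]    = above-step a i
      above-chain a (i ∷ is) = above-step (above-chain a is) i

      below-hi : Inverts⁺ D (hi α) x → Below x
      below-hi = below-chain (inj₁ (inj₁ refl))

      above-lo : Inverts⁺ D y (lo α) → Above y
      above-lo = above-chain (inj₁ (inj₁ refl))

      hi≺lo : hi α ≺ lo α
      hi≺lo = inj₂ [ inverts α α∈D (≤-refl , lo<hi α , ≤-refl , inj₁ refl , inj₁ refl) ]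

      right⇒≺hi : Between α c → left α c ≡ false → c ≺ hi α
      right⇒≺hi {c} (lo<c , c<hi) f = inj₁ (c<hi , ¬is)
        where
        ¬is : ¬ Inverts⁺ D (hi α) c
        ¬is is with below-hi is
        ... | inj₁ (inj₁ c≡hi) = <⇒≢ c<hi c≡hi
        ... | inj₁ (inj₂ (_ , t)) with () ← trans (sym t) f
        ... | inj₂ (inj₁ c≡lo) = <⇒≢ lo<c (sym c≡lo)
        ... | inj₂ (inj₂ js) = <-asym lo<c (inverts⁺⇒> js)

      left⇒lo≺ : Between α c → left α c ≡ true → lo α ≺ c
      left⇒lo≺ {c} (lo<c , c<hi) t = inj₁ (lo<c , ¬is)
        where
        ¬is : ¬ Inverts⁺ D c (lo α)
        ¬is is with above-lo is
        ... | inj₁ (inj₁ c≡lo) = <⇒≢ lo<c (sym c≡lo)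
        ... | inj₁ (inj₂ (_ , f)) with () ← trans (sym t) f
        ... | inj₂ (inj₁ c≡hi) = <⇒≢ c<hi c≡hi
        ... | inj₂ (inj₂ js) = <-asym c<hi (inverts⁺⇒> js)

      -- For `c` strictly between the ends, its side decides. For `c` below `lo α`, either no chain
      -- leads from `hi α` to `c`, so `c ≺ hi α`, or `Below c` turns it into a chain from `lo α`;
      -- dually above `hi α`.
      ≺hi-or-lo≺ : c ≢ lo α → c ≢ hi α → c ≺ hi α ⊎ lo α ≺ c
      ≺hi-or-lo≺ {c} c≢lo c≢hi with <-cmp c (lo α) | <-cmp c (hi α)
      ... | tri≈ _ c≡lo _ | _ = contradiction c≡lo c≢lo
      ... | _ | tri≈ _ c≡hi _ = contradiction c≡hi c≢hi
      ... | tri> _ _ lo<c | tri< c<hi _ _ with left α c in eq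
      ...   | true  = inj₂ (left⇒lo≺ (lo<c , c<hi) eq)
      ...   | false = inj₁ (right⇒≺hi (lo<c , c<hi) eq)
      ≺hi-or-lo≺ {c} c≢lo c≢hi | tri< c<lo _ _ | _ with inverts⁺? D (hi α) c
      ... | no ¬is = inj₁ (inj₁ (<-trans c<lo (lo<hi α) , ¬is))
      ... | yes is with below-hi is
      ...   | inj₁ (inj₁ c≡hi) = contradiction c≡hi c≢hi
      ...   | inj₁ (inj₂ ((lo<c , _) , _)) = contradiction lo<c (<-asym c<lo)
      ...   | inj₂ (inj₁ c≡lo) = contradiction c≡lo c≢lo
      ...   | inj₂ (inj₂ js) = inj₂ (inj₂ js)
      ≺hi-or-lo≺ {c} c≢lo c≢hi | _ | tri> _ _ hi<c with inverts⁺? D c (lo α)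
      ... | no ¬is = inj₂ (inj₁ (<-trans (lo<hi α) hi<c , ¬is))
      ... | yes is with above-lo is
      ...   | inj₁ (inj₁ c≡lo) = contradiction c≡lo c≢lo
      ...   | inj₁ (inj₂ ((_ , c<hi) , _)) = contradiction c<hi (<-asym hi<c)
      ...   | inj₂ (inj₁ c≡hi) = contradiction c≡hi c≢hi
      ...   | inj₂ (inj₂ js) = inj₁ (inj₂ js)

    -- The chain from a to b has length one, and hi α, lo α lie weakly between a and b for ≺.
    cover⇒arc : ∀ {b a} → b < a → a ≺ b → (∀ {c} → a ≺ c → ¬ c ≺ b) →
                ∃ λ α → α ∈ₐ D × lo α ≡ b × hi α ≡ a
    cover⇒arc {b} {a} b<a a≺b cover with ≺∧>⇒inverts⁺ a≺b b<a
    ... | i ∷ is = ⊥-elim (cover (inj₂ [ i ]) (inj₂ is))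
    ... | [ i ] with inverts-arc i
    ...   | α , α∈D , lo≤b , _ , a≤hi , u , l = α , α∈D , lo≡b l , hi≡a u
      where
      b-at-or-after : Lower α b → lo α ≡ b ⊎ lo α ≺ b
      b-at-or-after (inj₁ b≡lo) = inj₁ (sym b≡lo)
      b-at-or-after (inj₂ t) with lo α ≟ b
      ... | yes lo≡b = inj₁ lo≡b
      ... | no  lo≢b = inj₂ (left⇒lo≺ α α∈D (≤∧≢⇒< lo≤b lo≢b , <-≤-trans b<a a≤hi) t)
      a-at-or-before : Upper α a → hi α ≡ a ⊎ a ≺ hi α
      a-at-or-before (inj₁ a≡hi) = inj₁ (sym a≡hi)
      a-at-or-before (inj₂ f) with hi α ≟ a
      ... | yes hi≡a = inj₁ hi≡a
      ... | no  hi≢a = inj₂ (right⇒≺hi α α∈D (≤-<-trans lo≤b b<a , ≤∧≢⇒< a≤hi (hi≢a ∘ sym)) f)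
      a≺lo : Upper α a → a ≺ lo α
      a≺lo u with a-at-or-before u
      ... | inj₁ refl = hi≺lo α α∈D
      ... | inj₂ a≺hi = ≺-trans a≺hi (hi≺lo α α∈D)
      lo≡b : Lower α b → lo α ≡ b
      lo≡b l with b-at-or-after l
      ... | inj₁ eq = eq
      ... | inj₂ lo≺b = ⊥-elim (cover (a≺lo u) lo≺b)
      hi≺b : Lower α b → hi α ≺ b
      hi≺b l with b-at-or-after l
      ... | inj₁ refl = hi≺lo α α∈D
      ... | inj₂ lo≺b = ≺-trans (hi≺lo α α∈D) lo≺b
      hi≡a : Upper α a → hi α ≡ a
      hi≡a u with a-at-or-before u
      ... | inj₁ eq = eq
      ... | inj₂ a≺hi = ⊥-elim (cover a≺hi (hi≺b l))

-- Finite linear orders as permutations.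

-- Pigeonhole: if `y` were missed, `punchOut` would inject `Fin (suc k)` into `Fin k`.
injective⇒preimage : {f : Fin m → Fin m} → Injective _≡_ _≡_ f → ∀ y → ∃ λ x → f x ≡ y
injective⇒preimage {suc k} {f} inj y with Fin.any? (λ x → f x ≟ y)
... | yes found = found
... | no  none  = contradiction (injective⇒≤ punched-inj) ℕ.1+n≰n
  where
  missed : ∀ x → y ≢ f x
  missed x y≡fx = none (x , sym y≡fx)
  punched-inj : Injective _≡_ _≡_ (λ x → punchOut (missed x))
  punched-inj {x} {x′} = inj ∘ punchOut-injective (missed x) (missed x′)

module _ {_≺_ : Fin m → Fin m → Set} (sto : IsStrictTotalOrder _≡_ _≺_) where
  open IsStrictTotalOrder sto using (compare; irrefl) renaming (_<?_ to _≺?_; trans to ≺-trans)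

  private
    down : Fin m → Subset m
    down y = tabulate λ x → does (x ≺? y)

    ∈down⁺ : x ≺ y → x ∈ down y
    ∈down⁺ {x} {y} x≺y = lookup⇒[]= x _ (trans (lookup∘tabulate _ x) (dec-true (x ≺? y) x≺y))

    ∈down⁻ : x ∈ down y → x ≺ y
    ∈down⁻ {x} {y} x∈ with x ≺? y | trans (sym (lookup∘tabulate (λ z → does (z ≺? y)) x)) ([]=⇒lookup x∈)
    ... | yes x≺y | _ = x≺y

    rank : Fin m → Fin m
    -- `y` is missing from its own `down` set, so the cardinality is below `m`.
    rank y = fromℕ< (subst (∣ down y ∣ ℕ.<_) (∣⊤∣≡n m)
      (p⊂q⇒∣p∣<∣q∣ ((λ _ → ∈⊤) , y , ∈⊤ , irrefl refl ∘ ∈down⁻)))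

    rank-mono : x ≺ y → rank x < rank y
    rank-mono {x} {y} x≺y = subst₂ ℕ._<_ (sym (toℕ-fromℕ< _)) (sym (toℕ-fromℕ< _))
      (p⊂q⇒∣p∣<∣q∣ ((λ z∈ → ∈down⁺ (≺-trans (∈down⁻ z∈) x≺y)) , x , ∈down⁺ x≺y , irrefl refl ∘ ∈down⁻))

    rank-injective : Injective _≡_ _≡_ rank
    rank-injective {x} {y} eq with compare x y
    ... | tri< x≺y _ _ = contradiction eq (<⇒≢ (rank-mono x≺y))
    ... | tri≈ _ x≡y _ = x≡y
    ... | tri> _ _ y≺x = contradiction (sym eq) (<⇒≢ (rank-mono y≺x))

  -- The number of predecessors of a value serves as its position, so `rank` is the inverse
  -- direction `⟨$⟩ˡ`.
  linearisation : Σ[ π ∈ Permutation m m ] (∀ {x y} → x ≺ y → π ⟨$⟩ˡ x < π ⟨$⟩ˡ y)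
  linearisation = permutation (proj₁ ∘ preimage) rank
      (λ y → rank-injective (proj₂ (preimage (rank y)))) (proj₂ ∘ preimage)
    , rank-mono
    where
    preimage : ∀ y → ∃ λ x → rank x ≡ y
    preimage = injective⇒preimage rank-injective

-- If `f i < i`, monotonicity gives `f (f i) < f i`, an infinite descent.
strictMono⇒≤ : {f : Fin m → Fin m} → (∀ {i j} → i < j → f i < f j) → ∀ i → i ≤ f i
strictMono⇒≤ {f = f} mono i = ≮⇒≥ (go (<-wellFounded i))
  where
  go : ∀ {i} → Acc _<_ i → ¬ f i < i
  go (acc rec) fi<i = go (rec fi<i) (mono fi<i)

-- Membership in `δ π` without lists.

⟨$⟩ˡ-injective : (π : Permutation m m) → π ⟨$⟩ˡ x ≡ π ⟨$⟩ˡ y → x ≡ y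
⟨$⟩ˡ-injective π eq = trans (sym (inverseʳ π)) (trans (cong (π ⟨$⟩ʳ_) eq) (inverseʳ π))

consecutive⁺ : ∀ {i j : Fin m} → toℕ j ≡ suc (toℕ i) → (i , j) ∈ˡ consecutive m
consecutive⁺ {suc m} {i} {suc k} eq =
  subst (λ a → (a , suc k) ∈ˡ consecutive (suc m)) (toℕ-injective (trans (toℕ-inject₁ k) (suc-injective eq)))
    (∈-map⁺ (λ i → inject₁ i , suc i) (∈-allFin k))

consecutive⁻ : ∀ {i j : Fin m} → (i , j) ∈ˡ consecutive m → toℕ j ≡ suc (toℕ i)
consecutive⁻ {suc m} ∈c with ∈-map⁻ (λ i → inject₁ i , suc i) ∈c
... | k , _ , refl = cong suc (sym (toℕ-inject₁ k))

module _ (π : Permutation m m) where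

  -- Describes the members of `δ π`, as `descent⇒∈δ` and `∈δ⇒descent` show. Sides are compared with
  -- `hi α` alone, since `lo α` holds the very next position.
  record IsDescentArc (α : Arc m) : Set where
    field
      adjacent     : toℕ (π ⟨$⟩ˡ lo α) ≡ suc (toℕ (π ⟨$⟩ˡ hi α))
      left⇒after   : ∀ {c} → Between α c → left α c ≡ true  → π ⟨$⟩ˡ hi α < π ⟨$⟩ˡ c
      right⇒before : ∀ {c} → Between α c → left α c ≡ false → π ⟨$⟩ˡ c < π ⟨$⟩ˡ hi α

    before⇒right : ∀ {c} → Between α c → π ⟨$⟩ˡ c ≤ π ⟨$⟩ˡ hi α → left α c ≡ false
    before⇒right {c} b c≤hi with left α c in eq
    ... | false = refl
    ... | true  = contradiction c≤hi (<⇒≱ (left⇒after b eq))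

    after⇒left : ∀ {c} → Between α c → π ⟨$⟩ˡ hi α ≤ π ⟨$⟩ˡ c → left α c ≡ true
    after⇒left {c} b hi≤c with left α c in eq
    ... | true  = refl
    ... | false = contradiction hi≤c (<⇒≱ (right⇒before b eq))

    hi<lo : π ⟨$⟩ˡ hi α < π ⟨$⟩ˡ lo α
    hi<lo = ≤-reflexive (sym adjacent)

  open IsDescentArc

  -- The helper inside δ is not exported by Defs, but unification can still name it.
  private
    δ-step : Σ[ f ∈ (Fin m × Fin m → List (Arc m)) ] concatMap f (consecutive m) ≡ δ π
    δ-step = _ , refl

  descentArc∈step : ∀ {i j} → π ⟨$⟩ʳ j < π ⟨$⟩ʳ i →
                    ∃ λ lt → descentArc π i (π ⟨$⟩ʳ j) (π ⟨$⟩ʳ i) lt ∈ˡ proj₁ δ-step (i , j)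
  descentArc∈step {i} {j} lt with (π ⟨$⟩ʳ j) <? (π ⟨$⟩ʳ i)
  ... | yes lt′ = lt′ , here refl
  ... | no ≮    = contradiction lt ≮

  ∈δ⁺ : ∀ {i j} (lt : π ⟨$⟩ʳ j < π ⟨$⟩ʳ i) → toℕ j ≡ suc (toℕ i) → (α : Arc m) →
        α ≈ₐ descentArc π i (π ⟨$⟩ʳ j) (π ⟨$⟩ʳ i) lt → α ∈ₐ δ π
  ∈δ⁺ lt eq α α≈ = concatMap⁺ _ (lose (consecutive⁺ eq) (lose (proj₂ (descentArc∈step lt)) α≈))

  descent⇒∈δ : (α : Arc m) → IsDescentArc α → α ∈ₐ δ π
  descent⇒∈δ α d = ∈δ⁺ (subst₂ _<_ (sym (inverseʳ π)) (sym (inverseʳ π)) (lo<hi α)) (adjacent d) α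
    (sym (inverseʳ π) , sym (inverseʳ π) , sides)
    where
    sides : ∀ c → Between α c → left α c ≡ not ⌊ (π ⟨$⟩ˡ c) ≤? (π ⟨$⟩ˡ hi α) ⌋
    sides c b with (π ⟨$⟩ˡ c) ≤? (π ⟨$⟩ˡ hi α)
    ... | yes c≤hi = before⇒right d b c≤hi
    ... | no  c≰hi = after⇒left d b (<⇒≤ (≰⇒> c≰hi))

  ∈δ⇒descent : (α : Arc m) → α ∈ₐ δ π → IsDescentArc α
  ∈δ⇒descent α α∈ with find (concatMap⁻ _ {xs = consecutive m} α∈)
  ... | (i , j) , ij∈ , α∈step with (π ⟨$⟩ʳ j) <? (π ⟨$⟩ʳ i)
  ∈δ⇒descent α α∈ | (i , j) , ij∈ , here (refl , refl , sides) | yes _ = record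
    { adjacent = trans (cong toℕ (inverseˡ π)) (trans (consecutive⁻ ij∈) (cong (suc ∘ toℕ) (sym (inverseˡ π))))
    ; left⇒after = λ {c} b t → subst (_< π ⟨$⟩ˡ c) (sym (inverseˡ π)) (after c (trans (sym (sides c b)) t))
    -- `descentArc` tests positions with `≤`; equality would make `c` the upper endpoint, which
    -- `Between` excludes.
    ; right⇒before = λ {c} b f → subst (π ⟨$⟩ˡ c <_) (sym (inverseˡ π))
        (≤∧≢⇒< (before c (trans (sym (sides c b)) f))
          λ eq → <⇒≢ (proj₂ b) (trans (sym (inverseʳ π)) (cong (π ⟨$⟩ʳ_) eq)))
    }
    where
    after : ∀ c → not ⌊ (π ⟨$⟩ˡ c) ≤? i ⌋ ≡ true → i < π ⟨$⟩ˡ c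
    after c t with (π ⟨$⟩ˡ c) ≤? i
    ... | no c≰i = ≰⇒> c≰i
    before : ∀ c → not ⌊ (π ⟨$⟩ˡ c) ≤? i ⌋ ≡ false → π ⟨$⟩ˡ c ≤ i
    before c f with (π ⟨$⟩ˡ c) ≤? i
    ... | yes c≤i = c≤i

  descent-unique : (α β : Arc m) → IsDescentArc α → IsDescentArc β → hi α ≡ hi β → α ≈ₐ β
  descent-unique α β dα dβ refl = lo≡ , refl , sides
    where
    lo≡ : lo α ≡ lo β
    lo≡ = ⟨$⟩ˡ-injective π (toℕ-injective (trans (adjacent dα) (sym (adjacent dβ))))
    sides : ∀ c → Between α c → left α c ≡ left β c
    sides c b@(lo<c , c<hi) with left α c in eq
    ... | true  = sym (after⇒left dβ (subst (_< c) lo≡ lo<c , c<hi) (<⇒≤ (left⇒after dα b eq)))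
    ... | false = sym (before⇒right dβ (subst (_< c) lo≡ lo<c , c<hi) (<⇒≤ (right⇒before dα b eq)))

  -- Descent arcs do not cross.

  before⇒1≤pos : (α : Arc m) → IsDescentArc α → InRange α c → π ⟨$⟩ˡ c ≤ π ⟨$⟩ˡ hi α → 1 ℕ.≤ pos α c
  before⇒1≤pos α d r c≤hi with endpoint-or-between α r
  ... | inj₁ refl        = ≤-reflexive (sym (pos-lo α))
  ... | inj₂ (inj₁ refl) = ≤-reflexive (sym (pos-hi α))
  ... | inj₂ (inj₂ b)    = Upper⇒1≤pos α (inj₂ (before⇒right d b c≤hi))

  before⇒pos≡2 : (α : Arc m) → IsDescentArc α → InRange α c → π ⟨$⟩ˡ c < π ⟨$⟩ˡ hi α → pos α c ≡ 2
  before⇒pos≡2 α d r c<hi with endpoint-or-between α r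
  ... | inj₁ refl        = contradiction c<hi (<-asym (hi<lo d))
  ... | inj₂ (inj₁ refl) = contradiction c<hi (<-irrefl refl)
  ... | inj₂ (inj₂ b)    = pos-right α b (before⇒right d b (<⇒≤ c<hi))

  after⇒pos≤1 : (α : Arc m) → IsDescentArc α → InRange α c → π ⟨$⟩ˡ hi α < π ⟨$⟩ˡ c → pos α c ℕ.≤ 1
  after⇒pos≤1 α d r hi<c with endpoint-or-between α r
  ... | inj₁ refl        = ≤-reflexive (pos-lo α)
  ... | inj₂ (inj₁ refl) = ≤-reflexive (pos-hi α)
  ... | inj₂ (inj₂ b)    = Lower⇒pos≤1 α (inj₂ (after⇒left d b (<⇒≤ hi<c)))

  after⇒pos≡0 : (α : Arc m) → IsDescentArc α → InRange α c → π ⟨$⟩ˡ lo α < π ⟨$⟩ˡ c → pos α c ≡ 0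
  after⇒pos≡0 α d r lo<c with endpoint-or-between α r
  ... | inj₁ refl        = contradiction lo<c (<-irrefl refl)
  ... | inj₂ (inj₁ refl) = contradiction lo<c (<-asym (hi<lo d))
  ... | inj₂ (inj₂ b)    = pos-left α b (after⇒left d b (<⇒≤ (<-trans (hi<lo d) lo<c)))

  pos≤2 : (α : Arc m) (c : Fin m) → pos α c ℕ.≤ 2
  pos≤2 α c with c ≟ lo α | c ≟ hi α
  ... | yes _ | _     = s≤s z≤n
  ... | no _  | yes _ = s≤s z≤n
  ... | no _  | no _ with left α c
  ...   | true  = z≤n
  ...   | false = ≤-refl

  -- At a value before `hi β`, `β` is as far right as possible; at `hi β` itself, 1 separates the
  -- two positions; at a later value `α` is as far left as possible. So descent arcs are ordered
  -- from left to right by the positions of their upper endpoints.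
  pos-mono : (α β : Arc m) → IsDescentArc α → IsDescentArc β → π ⟨$⟩ˡ hi α < π ⟨$⟩ˡ hi β →
             InRange α c → InRange β c → pos α c ℕ.≤ pos β c
  pos-mono {c} α β dα dβ α<β rα rβ with <-cmp (π ⟨$⟩ˡ c) (π ⟨$⟩ˡ hi β)
  ... | tri< c<β _ _ = subst (pos α c ℕ.≤_) (sym (before⇒pos≡2 β dβ rβ c<β)) (pos≤2 α c)
  ... | tri≈ _ c≡β _ = ≤-trans (after⇒pos≤1 α dα rα (subst (π ⟨$⟩ˡ hi α <_) (sym c≡β) α<β))
                               (before⇒1≤pos β dβ rβ (≤-reflexive (cong toℕ c≡β)))
  -- `lo α` directly follows `hi α`, so it is no later than `hi β` and hence before `c`.
  ... | tri> _ _ β<c = subst (ℕ._≤ pos β c)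
    (sym (after⇒pos≡0 α dα rα (≤-<-trans (subst (ℕ._≤ _) (sym (adjacent dα)) α<β) β<c))) z≤n

  δ-noncrossing : NoncrossingDiagram (δ π)
  δ-noncrossing α β α∈ β∈ α≉β = ¬cross , lo≢ , hi≢
    where
    dα = ∈δ⇒descent α α∈
    dβ = ∈δ⇒descent β β∈
    hi≢ : hi α ≢ hi β
    hi≢ = α≉β ∘ descent-unique α β dα dβ
    lo≢ : lo α ≢ lo β
    lo≢ lo≡ = hi≢ (⟨$⟩ˡ-injective π (toℕ-injective (suc-injective
      (trans (sym (adjacent dα)) (trans (cong (toℕ ∘ (π ⟨$⟩ˡ_)) lo≡) (adjacent dβ))))))
    ¬cross : ¬ Crosses α β
    ¬cross (c , c′ , rα , rβ , rα′ , rβ′ , lt , lt′) with <-cmp (π ⟨$⟩ˡ hi α) (π ⟨$⟩ˡ hi β)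
    ... | tri< α<β _ _ = <⇒≱ lt′ (pos-mono α β dα dβ α<β rα′ rβ′)
    ... | tri≈ _ eq _  = hi≢ (⟨$⟩ˡ-injective π eq)
    ... | tri> _ _ β<α = <⇒≱ lt (pos-mono β α dβ dα β<α rβ rα)

  -- Inversions of `π` as the closure of `δ π`.

  inverts⇒before : Inverts (δ π) y x → π ⟨$⟩ˡ y < π ⟨$⟩ˡ x
  inverts⇒before {y} {x} i with inverts-arc i
  ... | α , α∈ , lo≤x , x<y , y≤hi , u , l = ≤-<-trans (at-or-before u) (after l)
    where
    d = ∈δ⇒descent α α∈
    at-or-before : Upper α y → π ⟨$⟩ˡ y ≤ π ⟨$⟩ˡ hi α
    at-or-before (inj₁ refl) = ≤-refl
    at-or-before (inj₂ f) with endpoint-or-between α (<⇒≤ (≤-<-trans lo≤x x<y) , y≤hi)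
    ... | inj₁ refl        = contradiction x<y (ℕ.≤⇒≯ lo≤x)
    ... | inj₂ (inj₁ refl) = ≤-refl
    ... | inj₂ (inj₂ b)    = <⇒≤ (right⇒before d b f)
    after : Lower α x → π ⟨$⟩ˡ hi α < π ⟨$⟩ˡ x
    after (inj₁ refl) = hi<lo d
    after (inj₂ t) with endpoint-or-between α (lo≤x , <⇒≤ (<-≤-trans x<y y≤hi))
    ... | inj₁ refl        = hi<lo d
    ... | inj₂ (inj₁ refl) = contradiction x<y (ℕ.≤⇒≯ y≤hi)
    ... | inj₂ (inj₂ b)    = left⇒after d b t

  inverts⁺⇒before : Inverts⁺ (δ π) y x → π ⟨$⟩ˡ y < π ⟨$⟩ˡ x
  inverts⁺⇒before [ i ]    = inverts⇒before i
  inverts⁺⇒before (i ∷ is) = <-trans (inverts⇒before i) (inverts⁺⇒before is)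

  descentArc-isDescent : ∀ {i j} (lt : π ⟨$⟩ʳ j < π ⟨$⟩ʳ i) → toℕ j ≡ suc (toℕ i) →
                         IsDescentArc (descentArc π i (π ⟨$⟩ʳ j) (π ⟨$⟩ʳ i) lt)
  descentArc-isDescent lt eq = ∈δ⇒descent (descentArc π _ _ _ lt) (∈δ⁺ lt eq (descentArc π _ _ _ lt) (≈ₐ-refl (descentArc π _ _ _ lt)))

  -- Scan the positions from y towards x: the first descent below y yields an arc that inverts
  -- y with x or with some z strictly between.
  before⇒inverts⁺ : x < y → π ⟨$⟩ˡ y < π ⟨$⟩ˡ x → Inverts⁺ (δ π) y x
  before⇒inverts⁺ {x} {y} x<y y≺x =
    scan (>-wellFounded (π ⟨$⟩ˡ y)) x<y ≤-refl y≺x (≤-reflexive (cong toℕ (sym (inverseʳ π))))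
    where
    -- Invariant: `i` is at or after the position of `y` and before that of `x`, and its value is at
    -- least `y`. A next value `w < y` therefore makes a descent at `i`.
    scan : ∀ {i y} → Acc _>_ i → x < y → π ⟨$⟩ˡ y ≤ i → i < π ⟨$⟩ˡ x → y ≤ π ⟨$⟩ʳ i → Inverts⁺ (δ π) y x
    scan {i} {y} (acc rec) x<y y≤i i<x y≤πi = next (<-cmp w y)
      where
      i+1<m : suc (toℕ i) ℕ.< m
      i+1<m = ≤-<-trans i<x (toℕ<n (π ⟨$⟩ˡ x))
      j w : Fin m
      j = fromℕ< i+1<m
      w = π ⟨$⟩ʳ j
      j≡ : toℕ j ≡ suc (toℕ i)
      j≡ = toℕ-fromℕ< i+1<m
      i<j : i < j
      i<j = ≤-reflexive (sym j≡)
      j<x : w ≢ x → j < π ⟨$⟩ˡ x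
      j<x w≢x = ≤∧≢⇒< (subst (ℕ._≤ _) (sym j≡) i<x)
        λ eq → w≢x (trans (cong (π ⟨$⟩ʳ_) eq) (inverseʳ π))
      skip : y ≤ w → Inverts⁺ (δ π) y x
      skip y≤w = scan (rec i<j) x<y (≤-trans y≤i (<⇒≤ i<j))
        (j<x λ w≡x → <⇒≱ x<y (subst (y ≤_) w≡x y≤w)) y≤w
      descend : w < y → Inverts⁺ (δ π) y x
      descend w<y = through (<-cmp w x)
        where
        w<πi = <-≤-trans w<y y≤πi
        γ : Arc m
        γ = descentArc π i w (π ⟨$⟩ʳ i) w<πi
        d : IsDescentArc γ
        d = descentArc-isDescent w<πi j≡
        upper : Upper γ y
        upper with y ≟ π ⟨$⟩ʳ i
        ... | yes y≡πi = inj₁ y≡πi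
        ... | no  y≢πi = inj₂ (before⇒right d (w<y , ≤∧≢⇒< y≤πi y≢πi)
                                (subst (π ⟨$⟩ˡ y ≤_) (sym (inverseˡ π)) y≤i))
        inverts-via-γ : ∀ {v} → w ≤ v → v < y → Lower γ v → Inverts (δ π) y v
        inverts-via-γ w≤v v<y l = inverts γ (descent⇒∈δ γ d) (w≤v , v<y , y≤πi , upper , l)
        through : _ → Inverts⁺ (δ π) y x
        through (tri< w<x _ _) = [ inverts-via-γ (<⇒≤ w<x) x<y (inj₂ (after⇒left d (w<x , <-≤-trans x<y y≤πi)
                                     (<⇒≤ (subst (_< π ⟨$⟩ˡ x) (sym (inverseˡ π)) i<x)))) ]
        through (tri≈ _ w≡x _) = [ inverts-via-γ (≤-reflexive (cong toℕ w≡x)) x<y (inj₁ (sym w≡x)) ]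
        -- The arc ends above `x`, so `y` is inverted with `w` and the scan restarts from position
        -- `j` with `w` in place of `y`.
        through (tri> _ w≢x x<w) = inverts-via-γ ≤-refl w<y (inj₁ refl)
          ∷ scan (rec i<j) x<w (≤-reflexive (cong toℕ (inverseˡ π))) (j<x w≢x) ≤-refl
      next : _ → Inverts⁺ (δ π) y x
      next (tri< w<y _ _) = descend w<y
      next (tri≈ _ w≡y _) = skip (≤-reflexive (cong toℕ (sym w≡y)))
      next (tri> _ _ y<w) = skip (<⇒≤ y<w)

-- Injectivity of `δ`.

_⊆D_ : Diagram m → Diagram m → Set
D ⊆D E = ∀ α → α ∈ₐ D → α ∈ₐ E

inverts⁺-⊆D : {D E : Diagram m} → D ⊆D E → Inverts⁺ D y x → Inverts⁺ E y x
inverts⁺-⊆D {D = D} {E} D⊆E = go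
  where
  step : Inverts D y x → Inverts E y x
  step i with α , α∈D , s ← inverts-arc i = inverts α (D⊆E α α∈D) s
  go : Inverts⁺ D y x → Inverts⁺ E y x
  go [ i ]    = [ step i ]
  go (i ∷ is) = step i ∷ go is

-- An inversion of `π` passes to `σ` by the first inclusion; if the pair is not inverted in `π`, an
-- inversion in `σ` would come back by the second.
before-⊆D : (π σ : Permutation m m) → δ π ⊆D δ σ → δ σ ⊆D δ π →
            π ⟨$⟩ˡ x < π ⟨$⟩ˡ y → σ ⟨$⟩ˡ x < σ ⟨$⟩ˡ y
before-⊆D {x = x} {y} π σ π⊆σ σ⊆π x≺y with <-cmp x y
... | tri≈ _ refl _ = contradiction x≺y (<-irrefl refl)
... | tri> _ _ y<x = inverts⁺⇒before σ (inverts⁺-⊆D π⊆σ (before⇒inverts⁺ π y<x x≺y))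
... | tri< x<y x≢y _ with <-cmp (σ ⟨$⟩ˡ x) (σ ⟨$⟩ˡ y)
...   | tri< x≺′y _ _ = x≺′y
...   | tri≈ _ eq _   = contradiction (⟨$⟩ˡ-injective σ eq) x≢y
...   | tri> _ _ y≺′x = contradiction x≺y
  (<-asym (inverts⁺⇒before π (inverts⁺-⊆D σ⊆π (before⇒inverts⁺ σ x<y y≺′x))))

-- `shift π σ` preserves the order of positions, so it never decreases a position; its inverse
-- `shift σ π` does the same, which forces the identity.
δ-injective : (π σ : Permutation m m) → δ π ⊆D δ σ → δ σ ⊆D δ π → ∀ i → π ⟨$⟩ʳ i ≡ σ ⟨$⟩ʳ i
δ-injective π σ π⊆σ σ⊆π i = trans (sym (inverseʳ σ)) (cong (σ ⟨$⟩ʳ_) (sym i≡))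
  where
  shift : Permutation _ _ → Permutation _ _ → Fin _ → Fin _
  shift π σ i = σ ⟨$⟩ˡ (π ⟨$⟩ʳ i)
  ≤-shift : (π σ : Permutation _ _) → δ π ⊆D δ σ → δ σ ⊆D δ π → ∀ i → i ≤ shift π σ i
  ≤-shift π σ π⊆σ σ⊆π = strictMono⇒≤ λ i<j →
    before-⊆D π σ π⊆σ σ⊆π (subst₂ _<_ (sym (inverseˡ π)) (sym (inverseˡ π)) i<j)
  i≡ : i ≡ σ ⟨$⟩ˡ (π ⟨$⟩ʳ i)
  i≡ = Fin.≤-antisym (≤-shift π σ π⊆σ σ⊆π i)
    (subst (shift π σ i ≤_) (trans (cong (π ⟨$⟩ˡ_) (inverseʳ σ)) (inverseˡ π))
      (≤-shift σ π σ⊆π π⊆σ (shift π σ i)))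

-- Surjectivity onto noncrossing diagrams.

adjacent⁺ : ∀ {i j : Fin m} → i < j → (∀ {k} → i < k → ¬ k < j) → toℕ j ≡ suc (toℕ i)
adjacent⁺ {m} {i} {j} i<j gap = ℕ.≤-antisym (≮⇒≥ λ i+1<j →
    let k<m = <-trans i+1<j (toℕ<n j) in
    gap (≤-reflexive (sym (toℕ-fromℕ< k<m))) (subst (ℕ._< toℕ j) (sym (toℕ-fromℕ< k<m)) i+1<j))
  i<j

-- The linearisation of `_≺_` works: by `≺hi-or-lo≺` the ends of each arc of `D` occupy consecutive
-- positions, and by `cover⇒arc` each descent has the endpoints of an arc of `D`.
δ-surjective : (D : Diagram m) → NoncrossingDiagram D →
               Σ[ π ∈ Permutation m m ] δ π ⊆D D × D ⊆D δ π
δ-surjective {m} D nc = π , δ⊆D , λ α → descent⇒∈δ π α ∘ isDescent α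
  where
  open Order D
  lin = linearisation ≺-isStrictTotalOrder
  π = proj₁ lin
  mono : x ≺ y → π ⟨$⟩ˡ x < π ⟨$⟩ˡ y
  mono = proj₂ lin
  reflects : π ⟨$⟩ˡ x < π ⟨$⟩ˡ y → x ≺ y
  reflects {x} {y} px<py with ≺-compare x y
  ... | tri< x≺y _ _  = x≺y
  ... | tri≈ _ refl _ = contradiction px<py (<-irrefl refl)
  ... | tri> _ _ y≺x  = contradiction px<py (<-asym (mono y≺x))

  isDescent : (α : Arc m) → α ∈ₐ D → IsDescentArc π α
  isDescent α α∈D = record
    { adjacent = adjacent⁺ hi<lo′ λ {k} hi<k k<lo →
        nothing-between (subst (_ <_) (sym (inverseˡ π)) hi<k) (subst (_< _) (sym (inverseˡ π)) k<lo)
    ; left⇒after = λ b t → <-trans hi<lo′ (mono (left⇒lo≺ nc α α∈D b t))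
    ; right⇒before = λ b f → mono (right⇒≺hi nc α α∈D b f)
    }
    where
    hi<lo′ = mono (hi≺lo nc α α∈D)
    nothing-between : π ⟨$⟩ˡ hi α < π ⟨$⟩ˡ c → ¬ π ⟨$⟩ˡ c < π ⟨$⟩ˡ lo α
    nothing-between {c} hi<c c<lo
      with ≺hi-or-lo≺ nc α α∈D {c} (λ { refl → <-irrefl refl c<lo }) (λ { refl → <-irrefl refl hi<c })
    ... | inj₁ c≺hi = <-asym hi<c (mono c≺hi)
    ... | inj₂ lo≺c = <-asym c<lo (mono lo≺c)

  δ⊆D : δ π ⊆D D
  -- `γ` is only known to share the endpoints of `α`; both being descent arcs of `π`, they are
  -- equivalent.
  δ⊆D α α∈δ = ∈ₐ-resp-≈ₐ γ α
      (descent-unique π γ α (isDescent γ γ∈D) d hi≡) γ∈D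
    where
    d = ∈δ⇒descent π α α∈δ
    cover : ∀ {c} → hi α ≺ c → ¬ c ≺ lo α
    cover hi≺c c≺lo = <⇒≱ (mono c≺lo)
      (subst (ℕ._≤ _) (sym (IsDescentArc.adjacent d)) (mono hi≺c))
    arc′ = cover⇒arc nc (lo<hi α) (reflects (IsDescentArc.hi<lo d)) cover
    γ : Arc m
    γ = proj₁ arc′
    γ∈D = proj₁ (proj₂ arc′)
    hi≡ = proj₂ (proj₂ (proj₂ arc′))

-- The half-turn and signed permutations.

opposite-adjacent : ∀ {i j : Fin m} → toℕ j ≡ suc (toℕ i) → toℕ (opposite i) ≡ suc (toℕ (opposite j))
opposite-adjacent {m} {i} {j} eq = trans (opposite-prop i) (trans (sym (cong (m ∸_) eq))
  (trans (ℕ.+-∸-assoc 1 (toℕ<n j)) (cong suc (sym (opposite-prop j)))))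

between-halfTurn : (α : Arc m) → Between (halfTurn α) c → Between α (opposite c)
between-halfTurn α (hi<c , c<lo) =
    subst (_< _) (opposite-involutive _) (opposite-< c<lo)
  , subst (_ <_) (opposite-involutive _) (opposite-< hi<c)

halfTurn-involutive : (α : Arc m) → halfTurn (halfTurn α) ≈ₐ α
halfTurn-involutive α = opposite-involutive _ , opposite-involutive _ ,
  λ c _ → trans (not-involutive _) (cong (left α) (opposite-involutive c))

isDescentArc-cong : (π σ : Permutation m m) (α : Arc m) → (∀ v → π ⟨$⟩ˡ v ≡ σ ⟨$⟩ˡ v) →
                    IsDescentArc π α → IsDescentArc σ α
isDescentArc-cong π σ α π≗σ d = record
  { adjacent     = subst₂ (λ i j → toℕ j ≡ suc (toℕ i)) (π≗σ _) (π≗σ _) (adjacent d)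
  ; left⇒after   = λ b t → subst₂ _<_ (π≗σ _) (π≗σ _) (left⇒after d b t)
  ; right⇒before = λ b f → subst₂ _<_ (π≗σ _) (π≗σ _) (right⇒before d b f)
  }
  where open IsDescentArc

-- Conjugation by the half-turn; `IsSigned π` amounts to `rotate π` agreeing with `π` pointwise.
rotate : Permutation m m → Permutation m m
rotate π = reverse ∘ₚ π ∘ₚ reverse

-- The half-turn reverses values and positions, so a descent stays a descent with its ends
-- exchanged, and before and after are swapped together with left and right.
isDescentArc-rotate : (π : Permutation m m) (α : Arc m) → IsDescentArc π α → IsDescentArc (rotate π) (halfTurn α)
isDescentArc-rotate {m} π α d = record
  { adjacent     = subst₂ (λ u v → toℕ (opposite (π ⟨$⟩ˡ u)) ≡ suc (toℕ (opposite (π ⟨$⟩ˡ v))))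
                     (sym (opposite-involutive _)) (sym (opposite-involutive _)) (opposite-adjacent (adjacent d))
  ; left⇒after   = λ b t → subst (λ u → opposite (π ⟨$⟩ˡ u) < _) (sym (opposite-involutive _))
                     (opposite-< (<-trans (right⇒before d (between-halfTurn α b) (not-injective t)) (hi<lo d)))
  ; right⇒before = λ {c} b f → subst (λ u → _ < opposite (π ⟨$⟩ˡ u)) (sym (opposite-involutive _))
                     (opposite-< (lo<after b (not-injective f)))
  }
  where
  open IsDescentArc
  lo<after : Between (halfTurn α) c → left α (opposite c) ≡ true → π ⟨$⟩ˡ lo α < π ⟨$⟩ˡ opposite c
  -- `left⇒after` gives a position past `hi α`, that is, at least that of `lo α`; injectivity
  -- excludes equality.
  lo<after b t = ≤∧≢⇒< (subst (ℕ._≤ _) (sym (adjacent d)) (left⇒after d (between-halfTurn α b) t))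
    (<⇒≢ (proj₁ (between-halfTurn α b)) ∘ ⟨$⟩ˡ-injective π)

δ-rotate : (π : Permutation m m) (α : Arc m) → α ∈ₐ δ π → halfTurn α ∈ₐ δ (rotate π)
δ-rotate π α = descent⇒∈δ (rotate π) (halfTurn α) ∘ isDescentArc-rotate π α ∘ ∈δ⇒descent π α

signed⇒centrallySymmetric : (π : Permutation m m) → IsSigned π → CentrallySymmetric (δ π)
signed⇒centrallySymmetric π signed α α∈ = descent⇒∈δ π (halfTurn α)
  (isDescentArc-cong (rotate π) π (halfTurn α) rotate≗ (isDescentArc-rotate π α (∈δ⇒descent π α α∈)))
  where
  πˡ-opposite : ∀ v → opposite (π ⟨$⟩ˡ v) ≡ π ⟨$⟩ˡ opposite v
  πˡ-opposite v = trans (sym (inverseˡ π))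
    (cong (π ⟨$⟩ˡ_) (trans (signed (π ⟨$⟩ˡ v)) (cong opposite (inverseʳ π {v}))))
  rotate≗ : ∀ v → opposite (π ⟨$⟩ˡ opposite v) ≡ π ⟨$⟩ˡ v
  rotate≗ v = trans (cong opposite (sym (πˡ-opposite v))) (opposite-involutive (π ⟨$⟩ˡ v))

-- By `δ-injective` it is enough that `δ (rotate π)` and `δ π` have the same arcs. Each inclusion
-- turns an arc twice, once by central symmetry and once by rotation.
centrallySymmetric⇒signed : (π : Permutation m m) → CentrallySymmetric (δ π) → IsSigned π
centrallySymmetric⇒signed π sym-δ i =
  trans (sym (opposite-involutive _)) (cong opposite (δ-injective (rotate π) π rotate⊆ ⊆rotate i))
  where
  ⊆rotate : δ π ⊆D δ (rotate π)
  ⊆rotate α α∈ = ∈ₐ-resp-≈ₐ (halfTurn (halfTurn α)) α (halfTurn-involutive α)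
    (δ-rotate π (halfTurn α) (sym-δ α α∈))
  rotate-rotate : ∀ v → rotate (rotate π) ⟨$⟩ˡ v ≡ π ⟨$⟩ˡ v
  rotate-rotate v = trans (opposite-involutive _) (cong (π ⟨$⟩ˡ_) (opposite-involutive v))
  rotate⊆ : δ (rotate π) ⊆D δ π
  rotate⊆ α α∈ = ∈ₐ-resp-≈ₐ (halfTurn (halfTurn α)) α (halfTurn-involutive α)
    (sym-δ (halfTurn α) (descent⇒∈δ π (halfTurn α)
      (isDescentArc-cong (rotate (rotate π)) π (halfTurn α) rotate-rotate
        (isDescentArc-rotate (rotate π) α (∈δ⇒descent (rotate π) α α∈)))))

theorem4p1 : (n : ℕ) →
    ((π : Permutation (n + n) (n + n)) → IsSigned π → CSNCDiagram (δ π))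
    × ((π σ : Permutation (n + n) (n + n)) → IsSigned π → IsSigned σ →
    δ π ≈D δ σ → (i : Fin (n + n)) → π ⟨$⟩ʳ i ≡ σ ⟨$⟩ʳ i)
    × ((D : Diagram (n + n)) → CSNCDiagram D →
    Σ (Permutation (n + n) (n + n)) (λ π → IsSigned π × δ π ≈D D))
theorem4p1 n =
    (λ π signed → δ-noncrossing π , signed⇒centrallySymmetric π signed)
  , (λ π σ _ _ π≈σ → δ-injective π σ (λ α → π≈σ α .Equivalence.to) (λ α → π≈σ α .Equivalence.from))
  , onto
  where
  onto : (D : Diagram (n + n)) → CSNCDiagram D → Σ (Permutation (n + n) (n + n)) (λ π → IsSigned π × δ π ≈D D)
  onto D (nc , cs) =
    let π , δ⊆D , D⊆δ = δ-surjective D nc in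
      π
    , centrallySymmetric⇒signed π (λ α α∈δ → D⊆δ (halfTurn α) (cs α (δ⊆D α α∈δ)))
    , λ α → mk⇔ (δ⊆D α) (D⊆δ α)
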